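{- If $T$ is a tree of order $n$, then $$\xi^d(T)-\xi^c(T)\le\begin{cases}\frac{25n^4}{96}-\frac{n^3}{6}-\frac{89n^2}{48}+\frac{19n}{6}-\frac{45}{32}, & n \text{ odd},\\[3pt] \frac{25n^4}{96}-\frac{n^3}{6}-\frac{43n^2}{24}+\frac{19n}{6}-2, & n\text{ even}.\end{cases}$$ Moreover, equality holds if and only if $T=P_n$.
   Context: For a vertex $v$ of a tree $T$: $\deg(v)$ is its degree, $\varepsilon(v)=\max_{u} d(v,u)$ its eccentricity, $D(v)=\sum_u d(v,u)$ its total distance ($d$ the path distance). $\xi^c(T)=\sum_v \varepsilon(v)\deg(v)$ and $\xi^d(T)=\sum_v\varepsilon(v)D(v)$. $P_n$ is the path on $n$ vertices. -}

module Defs where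

open import Data.Bool using (Bool; true; false; _∧_; _∨_; if_then_else_)
open import Data.Nat using (ℕ; zero; suc; _+_; _*_; _≤_; _⊔_; _%_; _^_)
import Data.Nat
open import Data.Fin using (Fin; toℕ)
open import Data.Fin.Properties using (_≟_)
open import Data.Fin.Permutation using (Permutation′; _⟨$⟩ʳ_)
open import Data.List using (List; []; _∷_; _∷ʳ_; length; map; foldr; allFin)
open import Data.Nat.ListAction using (sum)
open import Data.Bool.ListAction using (any)
open import Data.List.Relation.Unary.Linked using (Linked)
open import Data.List.Relation.Unary.Unique.Propositional using (Unique)
open import Data.Product using (Σ; ∃; ∃-syntax; _×_)
open import Data.Integer as ℤ using (ℤ; +_)
open import Relation.Nullary using (¬_)
open import Relation.Nullary.Decidable using (⌊_⌋)
open import Relation.Binary.PropositionalEquality using (_≡_)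

record Graph (n : ℕ) : Set where
  field
    adj   : Fin n → Fin n → Bool
    sym   : ∀ i j → adj i j ≡ adj j i
    irrefl : ∀ i → adj i i ≡ false
open Graph public

module _ {n : ℕ} (G : Graph n) where

  Adj : Fin n → Fin n → Set
  Adj i j = adj G i j ≡ true

  reach : ℕ → Fin n → Fin n → Bool
  reach zero    u v = ⌊ u ≟ v ⌋
  reach (suc k) u v = reach k u v ∨ any (λ w → reach k u w ∧ adj G w v) (allFin n)

  Connected : Set
  Connected = ∀ u v → ∃[ k ] reach k u v ≡ true

  Cycle : Set
  Cycle = ∃[ x ] ∃[ ys ] (2 ≤ length ys × Unique (x ∷ ys) × Linked Adj ((x ∷ ys) ∷ʳ x))

  Acyclic : Set
  Acyclic = ¬ Cycle

  IsTree : Set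
  IsTree = Connected × Acyclic

  -- least k ≤ fuel satisfying p (returns fuel if none)
  least : (ℕ → Bool) → ℕ → ℕ
  least p zero    = zero
  least p (suc f) = if p zero then zero else suc (least (λ k → p (suc k)) f)

  -- path distance = length of a shortest walk (walks of length < n suffice when connected)
  dist : Fin n → Fin n → ℕ
  dist u v = least (λ k → reach k u v) n

  deg : Fin n → ℕ
  deg v = sum (map (λ u → if adj G v u then 1 else 0) (allFin n))

  ecc : Fin n → ℕ
  ecc v = foldr _⊔_ 0 (map (dist v) (allFin n))

  totalDist : Fin n → ℕ
  totalDist v = sum (map (dist v) (allFin n))

  ξc : ℕ
  ξc = sum (map (λ v → ecc v * deg v) (allFin n))

  ξd : ℕ
  ξd = sum (map (λ v → ecc v * totalDist v) (allFin n))

pathAdj : ∀ {n} → Fin n → Fin n → Bool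
pathAdj i j = ⌊ suc (toℕ i) Data.Nat.≟ toℕ j ⌋ ∨ ⌊ suc (toℕ j) Data.Nat.≟ toℕ i ⌋

IsPath : ∀ {n} → Graph n → Set
IsPath {n} G = Σ (Permutation′ n) λ σ → ∀ i j → adj G (σ ⟨$⟩ʳ i) (σ ⟨$⟩ʳ j) ≡ pathAdj i j

-- 96 times the paper's upper bound, as an integer
bound96 : ℕ → ℤ
bound96 n with n % 2
... | zero  = + (25 * n ^ 4) ℤ.- + (16 * n ^ 3) ℤ.- + (172 * n ^ 2) ℤ.+ + (304 * n) ℤ.- + 192
... | suc _ = + (25 * n ^ 4) ℤ.- + (16 * n ^ 3) ℤ.- + (178 * n ^ 2) ℤ.+ + (304 * n) ℤ.- + 135

{-# OPTIONS --safe #-}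
module Submission where

-- Compare the connected graph G with a spanning tree t.
-- Writing far n for n when n ≥ 2 and 0 otherwise, ξᵈ − ξᶜ = ∑ᵤ ecc u · ∑ᵥ far (d u v), so
-- passing from G to t does not decrease it. Choose t to be grown leaf by leaf from a path
-- of length d = diam t, which is possible because otherwise t contains a longer path to
-- start from. By the four-point condition the eccentricity of u is the larger of its
-- distances to the two ends of that path, hence fixed while the tree grows. Since d ≤ m,
-- attaching a leaf to a tree with m edges adds at most 2 d · (1 + 2 + … + (m + 1)), which is
-- less than the increase when a path with m edges is prolonged. So only paths are extremal.

-- The comparison leaves little room. A leaf adds at most about m³, while the path gains about 25 m³
-- / 24, the derivative of its leading term 25 m⁴ / 96; the surplus is only m³ / 24. Hence the exact
-- values on paths, one polynomial per parity: they reduce the comparison to a polynomial with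
-- nonnegative coefficients. In a tree grown from an arbitrary vertex a new leaf could raise the
-- eccentricity of many old vertices. Starting from a diametral path confines each new contribution
-- to the pairs that contain the leaf. The multiples 2, 3, 6 and 96 of the sums clear denominators,
-- so the comparison stays in ℕ and integers enter only at the end.

module Trees where

  open import Data.Fin using (Fin; zero; suc; toℕ; fromℕ; inject₁)
  open import Data.Fin.Properties using (toℕ-fromℕ; toℕ-inject₁)
  open import Data.Nat
  open import Data.Nat.Properties
  open import Algebra.Properties.Semiring.Sum +-*-semiring
  open import Data.Nat.Tactic.RingSolver using (solve-∀)
  open import Data.Product using (∃-syntax; _×_; _,_)
  open import Data.Sum as Sum using (_⊎_; inj₁; inj₂)
  open import Function using (_∘_)
  open import Relation.Binary.PropositionalEquality

  -- The index counts edges: the vertices of t : Tree m are Fin (suc m), and grow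
  -- hangs a new leaf, numbered zero, on an existing vertex.
  data Tree : ℕ → Set where
    one  : Tree 0
    grow : ∀ {m} → Tree m → Fin (suc m) → Tree (suc m)

  path : ∀ d → Tree d
  path zero    = one
  path (suc d) = grow (path d) zero

  -- Distances in trees

  d⟨_⟩ : ∀ {m} → Tree m → Fin (suc m) → Fin (suc m) → ℕ
  d⟨ one ⟩      zero    zero    = 0
  d⟨ grow t p ⟩ zero    zero    = 0
  d⟨ grow t p ⟩ zero    (suc v) = suc (d⟨ t ⟩ p v)
  d⟨ grow t p ⟩ (suc u) zero    = suc (d⟨ t ⟩ u p)
  d⟨ grow t p ⟩ (suc u) (suc v) = d⟨ t ⟩ u v

  d-path : ∀ d u v → d⟨ path d ⟩ u v ≡ ∣ toℕ u - toℕ v ∣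
  d-path zero    zero    zero    = refl
  d-path (suc d) zero    zero    = refl
  d-path (suc d) zero    (suc v) = cong suc (d-path d zero v)
  d-path (suc d) (suc u) zero    = cong suc (trans (d-path d u zero) (∣-∣-identityʳ (toℕ u)))
  d-path (suc d) (suc u) (suc v) = d-path d u v

  d-refl : ∀ {m} (t : Tree m) u → d⟨ t ⟩ u u ≡ 0
  d-refl one        zero    = refl
  d-refl (grow t p) zero    = refl
  d-refl (grow t p) (suc u) = d-refl t u

  d≡0⇒≡ : ∀ {m} (t : Tree m) u v → d⟨ t ⟩ u v ≡ 0 → u ≡ v
  d≡0⇒≡ one        zero    zero    _  = refl
  d≡0⇒≡ (grow t p) zero    zero    _  = refl
  d≡0⇒≡ (grow t p) (suc u) (suc v) eq = cong suc (d≡0⇒≡ t u v eq)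

  d-sym : ∀ {m} (t : Tree m) u v → d⟨ t ⟩ u v ≡ d⟨ t ⟩ v u
  d-sym one        zero    zero    = refl
  d-sym (grow t p) zero    zero    = refl
  d-sym (grow t p) zero    (suc v) = cong suc (d-sym t p v)
  d-sym (grow t p) (suc u) zero    = cong suc (d-sym t u p)
  d-sym (grow t p) (suc u) (suc v) = d-sym t u v

  d-triangle : ∀ {m} (t : Tree m) u v w → d⟨ t ⟩ u w ≤ d⟨ t ⟩ u v + d⟨ t ⟩ v w
  d-triangle one        zero    zero    zero    = z≤n
  d-triangle (grow t p) zero    zero    w       = ≤-refl
  d-triangle (grow t p) zero    (suc v) zero    = z≤n
  d-triangle (grow t p) zero    (suc v) (suc w) = s≤s (d-triangle t p v w)
  d-triangle (grow t p) (suc u) zero    zero    = ≤-reflexive (sym (+-identityʳ _))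
  d-triangle (grow t p) (suc u) zero    (suc w) =
    ≤-trans (d-triangle t u p w) (+-mono-≤ (n≤1+n _) (n≤1+n _))
  d-triangle (grow t p) (suc u) (suc v) zero    =
    ≤-trans (s≤s (d-triangle t u v p)) (≤-reflexive (sym (+-suc _ _)))
  d-triangle (grow t p) (suc u) (suc v) (suc w) = d-triangle t u v w

  d≤edges : ∀ {m} (t : Tree m) u v → d⟨ t ⟩ u v ≤ m
  d≤edges one        zero    zero    = z≤n
  d≤edges (grow t p) zero    zero    = z≤n
  d≤edges (grow t p) zero    (suc v) = s≤s (d≤edges t p v)
  d≤edges (grow t p) (suc u) zero    = s≤s (d≤edges t u p)
  d≤edges (grow t p) (suc u) (suc v) = m≤n⇒m≤1+n (d≤edges t u v)

  -- Turns a distance into a walk; the last edge is the one peeled off because `reach` extends walks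
  -- at that end.
  penultimate : ∀ {m} (t : Tree m) u v {k} → d⟨ t ⟩ u v ≡ suc k →
                ∃[ w ] (d⟨ t ⟩ u w ≡ k × d⟨ t ⟩ w v ≡ 1)
  penultimate one        zero    zero            ()
  penultimate (grow t p) zero    (suc v) {zero}  eq = zero , refl , eq
  penultimate (grow t p) zero    (suc v) {suc k} eq
    with w , eq₁ , eq₂ ← penultimate t p v (suc-injective eq) = suc w , cong suc eq₁ , eq₂
  penultimate (grow t p) (suc u) zero            eq =
    suc p , suc-injective eq , cong suc (d-refl t p)
  penultimate (grow t p) (suc u) (suc v)         eq
    with w , eq₁ , eq₂ ← penultimate t u v eq = suc w , eq₁ , eq₂

  -- Of the three ways to pair four points, the two largest sums of distances agree; equivalently,
  -- each sum is at most one of the other two.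
  FourPoint : ∀ {m} → Tree m → (a b c e : Fin (suc m)) → Set
  FourPoint t a b c e =
    (d⟨ t ⟩ a b + d⟨ t ⟩ c e ≤ d⟨ t ⟩ a c + d⟨ t ⟩ b e) ⊎
    (d⟨ t ⟩ a b + d⟨ t ⟩ c e ≤ d⟨ t ⟩ a e + d⟨ t ⟩ b c)

  -- Replacing a single occurrence of the new leaf by `p` lowers all three sums by one. If the leaf
  -- occurs twice, the claim is a triangle inequality or an equality by symmetry.
  four-point : ∀ {m} (t : Tree m) a b c e → FourPoint t a b c e
  four-point one zero zero zero zero = inj₁ z≤n
  four-point (grow t p) zero zero c e = inj₁ (d-triangle′ c e)
    where
    d-triangle′ : ∀ c e → d⟨ grow t p ⟩ c e ≤ d⟨ grow t p ⟩ zero c + d⟨ grow t p ⟩ zero e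
    d-triangle′ c e = subst (λ x → d⟨ grow t p ⟩ c e ≤ x + d⟨ grow t p ⟩ zero e)
      (d-sym (grow t p) c zero) (d-triangle (grow t p) c zero e)
  four-point (grow t p) zero b zero e = inj₂ (≤-reflexive
    (trans (+-comm (d⟨ grow t p ⟩ zero b) _)
           (cong (d⟨ grow t p ⟩ zero e +_) (d-sym (grow t p) zero b))))
  four-point (grow t p) zero b c zero = inj₁ (≤-reflexive
    (trans (+-comm (d⟨ grow t p ⟩ zero b) _)
           (cong₂ _+_ (d-sym (grow t p) c zero) (d-sym (grow t p) zero b))))
  four-point (grow t p) a zero zero e = inj₁ ≤-refl
  four-point (grow t p) a zero c zero = inj₂ (≤-reflexive
    (cong (d⟨ grow t p ⟩ a zero +_) (d-sym (grow t p) c zero)))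
  four-point (grow t p) a b zero zero = inj₁ (≤-trans (≤-reflexive (+-identityʳ _))
    (subst (λ x → d⟨ grow t p ⟩ a b ≤ d⟨ grow t p ⟩ a zero + x)
      (d-sym (grow t p) zero b) (d-triangle (grow t p) a zero b)))
  four-point (grow t p) zero (suc b) (suc c) (suc e) =
    Sum.map s≤s s≤s (four-point t p b c e)
  four-point (grow t p) (suc a) zero (suc c) (suc e) =
    Sum.map (λ h → ≤-trans (s≤s h) (≤-reflexive (sym (+-suc _ _))))
            (λ h → ≤-trans (s≤s h) (≤-reflexive (sym (+-suc _ _)))) (four-point t a p c e)
  four-point (grow t p) (suc a) (suc b) zero (suc e) =
    Sum.map (λ h → ≤-trans (≤-reflexive (+-suc _ _)) (s≤s h))
            (λ h → ≤-trans (≤-reflexive (+-suc _ _))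
                     (≤-trans (s≤s h) (≤-reflexive (sym (+-suc _ _))))) (four-point t a b p e)
  four-point (grow t p) (suc a) (suc b) (suc c) zero =
    Sum.map (λ h → ≤-trans (≤-reflexive (+-suc _ _))
                     (≤-trans (s≤s h) (≤-reflexive (sym (+-suc _ _)))))
            (λ h → ≤-trans (≤-reflexive (+-suc _ _)) (s≤s h)) (four-point t a b c p)
  four-point (grow t p) (suc a) (suc b) (suc c) (suc e) = four-point t a b c e

  -- In the four-point condition for `u`, `v` against the diametral pair, the right side contains a
  -- distance from `v`, which is at most `d⟨ t ⟩ x y` and cancels.
  far-from-diametral : ∀ {m} (t : Tree m) x y → (∀ u v → d⟨ t ⟩ u v ≤ d⟨ t ⟩ x y) →
                       ∀ u v → d⟨ t ⟩ u v ≤ d⟨ t ⟩ u x ⊔ d⟨ t ⟩ u y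
  far-from-diametral t x y diam u v with four-point t u v x y
  ... | inj₁ h = ≤-trans (+-cancelʳ-≤ (d⟨ t ⟩ x y) _ _ (≤-trans h (+-monoʳ-≤ (d⟨ t ⟩ u x) (diam v y))))
                   (m≤m⊔n _ _)
  ... | inj₂ h = ≤-trans (+-cancelʳ-≤ (d⟨ t ⟩ x y) _ _ (≤-trans h (+-monoʳ-≤ (d⟨ t ⟩ u y) (diam v x))))
                   (m≤n⊔m _ _)

  -- The cost of one new leaf

  sum-mono : ∀ {n} {f g : Fin n → ℕ} → (∀ i → f i ≤ g i) → sum f ≤ sum g
  sum-mono {zero}  f≤g = z≤n
  sum-mono {suc n} f≤g = +-mono-≤ (f≤g zero) (sum-mono (f≤g ∘ suc))

  sum-tight : ∀ {n} {f g : Fin n → ℕ} → (∀ i → f i ≤ g i) → sum g ≤ sum f → ∀ i → f i ≡ g i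
  sum-tight {suc n} {f} {g} f≤g G≤F zero = ≤-antisym (f≤g zero)
    (+-cancelʳ-≤ (sum (g ∘ suc)) _ _
      (≤-trans G≤F (+-monoʳ-≤ (f zero) (sum-mono (f≤g ∘ suc)))))
  sum-tight {suc n} {f} {g} f≤g G≤F (suc i) = sum-tight (f≤g ∘ suc)
    (+-cancelˡ-≤ (g zero) _ _ (≤-trans G≤F (+-monoˡ-≤ (sum (f ∘ suc)) (f≤g zero)))) i

  sum-suc : ∀ {n} (f : Fin n → ℕ) → sum (suc ∘ f) ≡ n + sum f
  sum-suc {zero}  f = refl
  sum-suc {suc n} f = cong suc (begin
    f zero + sum (suc ∘ f ∘ suc)   ≡⟨ cong (f zero +_) (sum-suc (f ∘ suc)) ⟩
    f zero + (n + sum (f ∘ suc))   ≡⟨ lemma (f zero) n (sum (f ∘ suc)) ⟩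
    n + (f zero + sum (f ∘ suc))   ∎)
    where
    open ≡-Reasoning
    lemma : ∀ a b c → a + (b + c) ≡ b + (a + c)
    lemma = solve-∀

  -- The extreme case is an end of a path, 1 + 2 + ... + m. A new vertex adds at most `suc m`: as
  -- `u` itself it lengthens the `suc m` distances from `p` by one, otherwise it is one further
  -- distance.
  row-sum-bound : ∀ {m} (t : Tree m) u → 2 * sum (d⟨ t ⟩ u) ≤ m * suc m
  row-sum-bound one zero = z≤n
  row-sum-bound {suc m} (grow t p) zero = begin
    2 * sum (λ v → suc (d⟨ t ⟩ p v))   ≡⟨ cong (2 *_) (sum-suc (d⟨ t ⟩ p)) ⟩
    2 * (suc m + sum (d⟨ t ⟩ p))       ≡⟨ *-distribˡ-+ 2 (suc m) _ ⟩
    2 * suc m + 2 * sum (d⟨ t ⟩ p)     ≤⟨ +-monoʳ-≤ (2 * suc m) (row-sum-bound t p) ⟩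
    2 * suc m + m * suc m              ≡⟨ *-distribʳ-+ (suc m) 2 m ⟨
    (2 + m) * suc m                    ≡⟨ *-comm (2 + m) (suc m) ⟩
    suc m * suc (suc m)                ∎
    where
    open ≤-Reasoning
  row-sum-bound {suc m} (grow t p) (suc u) = begin
    2 * (suc (d⟨ t ⟩ u p) + sum (d⟨ t ⟩ u))   ≤⟨ *-monoʳ-≤ 2 (+-monoˡ-≤ _ (s≤s (d≤edges t u p))) ⟩
    2 * (suc m + sum (d⟨ t ⟩ u))              ≡⟨ *-distribˡ-+ 2 (suc m) _ ⟩
    2 * suc m + 2 * sum (d⟨ t ⟩ u)            ≤⟨ +-monoʳ-≤ (2 * suc m) (row-sum-bound t u) ⟩
    2 * suc m + m * suc m                     ≡⟨ *-distribʳ-+ (suc m) 2 m ⟨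
    (2 + m) * suc m                           ≡⟨ *-comm (2 + m) (suc m) ⟩
    suc m * suc (suc m)                       ∎
    where
    open ≤-Reasoning

  -- ξᵈ − ξᶜ counts a pair by its distance, except that neighbours cancel against the degree.
  far : ℕ → ℕ
  far 0                 = 0
  far 1                 = 0
  far n@(suc (suc _))   = n

  far≤ : ∀ n → far n ≤ n
  far≤ 0             = z≤n
  far≤ 1             = z≤n
  far≤ (suc (suc n)) = ≤-refl

  far-mono : ∀ {m n} → m ≤ n → far m ≤ far n
  far-mono {0}           {n}           _           = z≤n
  far-mono {1}           {n}           _           = z≤n
  far-mono {suc (suc m)} {1}           (s≤s ())
  far-mono {suc (suc m)} {suc (suc n)} m≤n         = m≤n

  -- For x and y at diametral distance, d u x ⊔ d u y is the eccentricity of u, so this is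
  -- ξᵈ − ξᶜ; unlike the eccentricity, d u x ⊔ d u y is unchanged when a vertex is attached.
  weight : ∀ {m} → Tree m → (x y : Fin (suc m)) → ℕ
  weight t x y = sum λ u → (d⟨ t ⟩ u x ⊔ d⟨ t ⟩ u y) * sum (λ v → far (d⟨ t ⟩ u v))

  -- The terms of old pairs do not change. The new pairs form a row and a column, each at most `d`
  -- times the sum `R` of the distances from the leaf, and `R` obeys the row bound of the larger
  -- tree.
  weight-grow : ∀ {m d} (t : Tree m) p x y → (∀ u v → d⟨ grow t p ⟩ u v ≤ d) →
                weight (grow t p) (suc x) (suc y) ≤ weight t x y + d * (suc m * suc (suc m))
  weight-grow {m} {d} t p x y diam = begin
    e₀ * sum (λ v → far (suc (d⟨ t ⟩ p v))) + sum (λ u → e u * (far (suc (d⟨ t ⟩ u p)) + s u))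
      ≡⟨ cong (e₀ * sum (λ v → far (suc (d⟨ t ⟩ p v))) +_)
           (trans (sum-cong-≗ (λ u → *-distribˡ-+ (e u) (far (suc (d⟨ t ⟩ u p))) (s u)))
                  (∑-distrib-+ (λ u → e u * far (suc (d⟨ t ⟩ u p))) (λ u → e u * s u))) ⟩
    e₀ * sum (λ v → far (suc (d⟨ t ⟩ p v))) +
      (sum (λ u → e u * far (suc (d⟨ t ⟩ u p))) + weight t x y)
      ≤⟨ +-mono-≤ (*-mono-≤ (⊔-lub (diam zero (suc x)) (diam zero (suc y)))
                            (sum-mono (λ v → far≤ (suc (d⟨ t ⟩ p v)))))
           (+-monoˡ-≤ (weight t x y) (sum-mono (λ u →
             *-mono-≤ (⊔-lub (diam (suc u) (suc x)) (diam (suc u) (suc y)))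
               (≤-trans (far≤ (suc (d⟨ t ⟩ u p))) (≤-reflexive (cong suc (d-sym t u p))))))) ⟩
    d * R + (sum (λ u → d * suc (d⟨ t ⟩ p u)) + weight t x y)
      ≡⟨ cong (λ z → d * R + (z + weight t x y)) (sym (*-distribˡ-sum d (λ u → suc (d⟨ t ⟩ p u)))) ⟩
    d * R + (d * R + weight t x y)         ≡⟨ lemma d R (weight t x y) ⟩
    weight t x y + d * (2 * R)
      ≤⟨ +-monoʳ-≤ (weight t x y) (*-monoʳ-≤ d (row-sum-bound (grow t p) zero)) ⟩
    weight t x y + d * (suc m * suc (suc m)) ∎
    where
    open ≤-Reasoning
    e : Fin (suc m) → ℕ
    e u = d⟨ t ⟩ u x ⊔ d⟨ t ⟩ u y
    e₀ : ℕ
    e₀ = suc (d⟨ t ⟩ p x) ⊔ suc (d⟨ t ⟩ p y)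
    s : Fin (suc m) → ℕ
    s u = sum (λ v → far (d⟨ t ⟩ u v))
    R : ℕ
    R = sum (λ v → suc (d⟨ t ⟩ p v))
    lemma : ∀ d r w → d * r + (d * r + w) ≡ w + d * (2 * r)
    lemma = solve-∀

  -- Sums along a path

  -- ∑△ h d sums h a b over a + b = d. The two extreme terms are split off first because
  -- a ⊔ b increases by exactly one when a and b both do.
  ∑△ : (ℕ → ℕ → ℕ) → ℕ → ℕ
  ∑△ h 0             = h 0 0
  ∑△ h 1             = h 0 1 + h 1 0
  ∑△ h (suc (suc d)) = h 0 (2 + d) + (∑△ (λ a b → h (suc a) (suc b)) d + h (2 + d) 0)

  ∑△-cong : ∀ {h k} d → (∀ a b → a + b ≡ d → h a b ≡ k a b) → ∑△ h d ≡ ∑△ k d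
  ∑△-cong 0             eq = eq 0 0 refl
  ∑△-cong 1             eq = cong₂ _+_ (eq 0 1 refl) (eq 1 0 refl)
  ∑△-cong (suc (suc d)) eq = cong₂ _+_ (eq 0 (2 + d) refl) (cong₂ _+_
    (∑△-cong d (λ a b a+b≡d → eq (suc a) (suc b)
      (cong suc (trans (+-suc a b) (cong suc a+b≡d)))))
    (eq (2 + d) 0 (+-identityʳ _)))

  ∑△-+ : ∀ h k d → ∑△ (λ a b → h a b + k a b) d ≡ ∑△ h d + ∑△ k d
  ∑△-+ h k 0 = refl
  ∑△-+ h k 1 = lemma (h 0 1) (k 0 1) (h 1 0) (k 1 0)
    where
    lemma : ∀ a b c e → a + b + (c + e) ≡ a + c + (b + e)
    lemma = solve-∀
  ∑△-+ h k (suc (suc d))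
    rewrite ∑△-+ (λ a b → h (suc a) (suc b)) (λ a b → k (suc a) (suc b)) d =
    lemma (h 0 (2 + d)) (k 0 (2 + d)) _ _ (h (2 + d) 0) (k (2 + d) 0)
    where
    lemma : ∀ a b c e f g → a + b + (c + e + (f + g)) ≡ a + (c + f) + (b + (e + g))
    lemma = solve-∀

  ∑△-* : ∀ c h d → ∑△ (λ a b → c * h a b) d ≡ c * ∑△ h d
  ∑△-* c h 0 = refl
  ∑△-* c h 1 = sym (*-distribˡ-+ c _ _)
  ∑△-* c h (suc (suc d)) rewrite ∑△-* c (λ a b → h (suc a) (suc b)) d =
    lemma c (h 0 (2 + d)) _ (h (2 + d) 0)
    where
    lemma : ∀ c x y z → c * x + (c * y + c * z) ≡ c * (x + (y + z))
    lemma = solve-∀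

  ∑△-1 : ∀ d → ∑△ (λ _ _ → 1) d ≡ suc d
  ∑△-1 0 = refl
  ∑△-1 1 = refl
  ∑△-1 (suc (suc d)) rewrite ∑△-1 d = cong suc (+-comm (suc d) 1)

  -- The complement `b` of `toℕ u` is given by an equation instead of a truncated subtraction, so
  -- both ends can be peeled at once.
  sum≡∑△ : ∀ d (f : Fin (suc d) → ℕ) h → (∀ u b → toℕ u + b ≡ d → f u ≡ h (toℕ u) b) →
           sum f ≡ ∑△ h d
  sum≡∑△ 0 f h eq = trans (+-identityʳ _) (eq zero 0 refl)
  sum≡∑△ 1 f h eq = cong₂ _+_ (eq zero 1 refl) (trans (+-identityʳ _) (eq (suc zero) 0 refl))
  sum≡∑△ (suc (suc d)) f h eq = cong₂ _+_ (eq zero (2 + d) refl)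
    (trans (sum-init-last (f ∘ suc)) (cong₂ _+_
      (sum≡∑△ d (λ u → f (suc (inject₁ u))) (λ a b → h (suc a) (suc b)) λ u b u+b≡d →
        trans (eq (suc (inject₁ u)) (suc b)
                (cong suc (trans (cong (_+ suc b) (toℕ-inject₁ u))
                                 (trans (+-suc (toℕ u) b) (cong suc u+b≡d)))))
              (cong (λ a → h (suc a) (suc b)) (toℕ-inject₁ u)))
      (trans (eq (suc (suc (fromℕ d))) 0 (trans (+-identityʳ _) (cong (2 +_) (toℕ-fromℕ d))))
             (cong (λ a → h (2 + a) 0) (toℕ-fromℕ d)))))

  ∑far : ℕ → ℕ
  ∑far zero    = 0
  ∑far (suc k) = ∑far k + far (suc k)

  -- `∑far (suc k)` is the triangular number (k + 1)(k + 2)/2 less one, since only distance 1 is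
  -- dropped. The formula fails for `∑far 0`, so the ends of a path are treated apart.
  2*∑far : ∀ k → 2 * ∑far (suc k) ≡ k * k + 3 * k
  2*∑far zero    = refl
  2*∑far (suc k) = begin
    2 * (∑far (suc k) + (2 + k))       ≡⟨ *-distribˡ-+ 2 (∑far (suc k)) (2 + k) ⟩
    2 * ∑far (suc k) + 2 * (2 + k)     ≡⟨ cong (_+ 2 * (2 + k)) (2*∑far k) ⟩
    k * k + 3 * k + 2 * (2 + k)        ≡⟨ lemma k ⟩
    suc k * suc k + 3 * suc k          ∎
    where
    open ≡-Reasoning
    lemma : ∀ k → k * k + 3 * k + 2 * (2 + k) ≡ suc k * suc k + 3 * suc k
    lemma = solve-∀

  sum-far-toℕ : ∀ d → sum {suc d} (far ∘ toℕ) ≡ ∑far d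
  sum-far-toℕ zero    = refl
  sum-far-toℕ (suc d) = trans (sum-init-last {suc d} (far ∘ toℕ)) (cong₂ _+_
    (trans (sum-cong-≗ (λ (u : Fin (suc d)) → cong far (toℕ-inject₁ u))) (sum-far-toℕ d))
    (cong far (toℕ-fromℕ (suc d))))

  path-row-sum : ∀ d u b → toℕ u + b ≡ d →
                 sum (λ v → far (d⟨ path d ⟩ u v)) ≡ ∑far (toℕ u) + ∑far b
  path-row-sum d       zero    b refl =
    trans (sum-cong-≗ (λ v → cong far (d-path d zero v))) (sum-far-toℕ d)
  path-row-sum (suc d) (suc u) b eq = begin
    far (suc (d⟨ path d ⟩ u zero)) + sum (λ v → far (d⟨ path d ⟩ u v))
      ≡⟨ cong₂ _+_ (cong (far ∘ suc) (trans (d-path d u zero) (∣-∣-identityʳ (toℕ u))))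
                   (path-row-sum d u b (suc-injective eq)) ⟩
    far (suc (toℕ u)) + (∑far (toℕ u) + ∑far b)
      ≡⟨ lemma (far (suc (toℕ u))) (∑far (toℕ u)) (∑far b) ⟩
    ∑far (toℕ u) + far (suc (toℕ u)) + ∑far b ∎
    where
    open ≡-Reasoning
    lemma : ∀ x y z → x + (y + z) ≡ y + x + z
    lemma = solve-∀

  d-path-left : ∀ d u → d⟨ path d ⟩ u zero ≡ toℕ u
  d-path-left d u = trans (d-path d u zero) (∣-∣-identityʳ (toℕ u))

  d-path-right : ∀ d u b → toℕ u + b ≡ d → d⟨ path d ⟩ u (fromℕ d) ≡ b
  d-path-right d u b eq = trans (d-path d u (fromℕ d))
    (trans (cong (∣ toℕ u -_∣) (trans (toℕ-fromℕ d) (sym eq))) (∣m-m+n∣≡n (toℕ u) b))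

  -- The value on a path: two-step recurrences and closed forms

  -- Twice the row sums of far in a path, away from the ends.
  q : ℕ → ℕ → ℕ
  q a b = (a * a + 3 * a) + (b * b + 3 * b)

  -- `Φ d` is ξᵈ - ξᶜ of the path with `d` edges. `G d` is twice the part of `Φ (2 + d)` that comes
  -- from interior vertices; `N` and `Q` arise on expanding the recurrence of `G`.
  Φ N Q G : ℕ → ℕ
  Φ = ∑△ (λ a b → (a ⊔ b) * (∑far a + ∑far b))
  N = ∑△ (λ a b → 2 + (a ⊔ b))
  Q = ∑△ q
  G = ∑△ (λ a b → suc (a ⊔ b) * q a b)

  weight-path : ∀ d → weight (path d) zero (fromℕ d) ≡ Φ d
  weight-path d = sum≡∑△ d _ _ λ u b eq →
    cong₂ _*_ (cong₂ _⊔_ (d-path-left d u) (d-path-right d u b eq)) (path-row-sum d u b eq)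

  Φ-step : ∀ d → 2 * Φ (2 + d) ≡ 2 * ((2 + d) * (suc d * suc d + 3 * suc d)) + G d
  Φ-step d = begin
    2 * ((2 + d) * S + (X + (2 + d) * (S + 0)))   ≡⟨ lemma d S X ⟩
    2 * ((2 + d) * (2 * S)) + 2 * X               ≡⟨ cong₂ (λ s x → 2 * ((2 + d) * s) + x) (2*∑far (suc d)) 2*X≡G ⟩
    2 * ((2 + d) * (suc d * suc d + 3 * suc d)) + G d ∎
    where
    open ≡-Reasoning
    S X : ℕ
    S = ∑far (2 + d)
    X = ∑△ (λ a b → suc (a ⊔ b) * (∑far (suc a) + ∑far (suc b))) d
    lemma : ∀ d s x → 2 * ((2 + d) * s + (x + (2 + d) * (s + 0))) ≡ 2 * ((2 + d) * (2 * s)) + 2 * x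
    lemma = solve-∀
    lemma₂ : ∀ m x y → 2 * (m * (x + y)) ≡ m * (2 * x + 2 * y)
    lemma₂ = solve-∀
    2*X≡G : 2 * X ≡ G d
    2*X≡G = trans (sym (∑△-* 2 (λ a b → suc (a ⊔ b) * (∑far (suc a) + ∑far (suc b))) d))
      (∑△-cong d λ a b _ → trans (lemma₂ (suc (a ⊔ b)) (∑far (suc a)) (∑far (suc b)))
        (cong₂ (λ x y → suc (a ⊔ b) * (x + y)) (2*∑far a) (2*∑far b)))

  N-step : ∀ d → N (2 + d) ≡ 2 * (4 + d) + (suc d + N d)
  N-step d = begin
    4 + d + (∑△ (λ a b → 1 + (2 + (a ⊔ b))) d + (4 + d))
      ≡⟨ cong (λ z → 4 + d + (z + (4 + d)))
           (trans (∑△-+ (λ _ _ → 1) (λ a b → 2 + (a ⊔ b)) d) (cong (_+ N d) (∑△-1 d))) ⟩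
    4 + d + (suc d + N d + (4 + d))   ≡⟨ lemma d (N d) ⟩
    2 * (4 + d) + (suc d + N d)       ∎
    where
    open ≡-Reasoning
    lemma : ∀ d n → 4 + d + (suc d + n + (4 + d)) ≡ 2 * (4 + d) + (suc d + n)
    lemma = solve-∀

  q-suc : ∀ {a b d} → a + b ≡ d → q (suc a) (suc b) ≡ q a b + (2 * d + 8)
  q-suc {a} {b} refl = lemma a b
    where
    lemma : ∀ a b → (suc a * suc a + 3 * suc a) + (suc b * suc b + 3 * suc b) ≡
                    (a * a + 3 * a) + (b * b + 3 * b) + (2 * (a + b) + 8)
    lemma = solve-∀

  Q-step : ∀ d → Q (2 + d) ≡
           2 * ((2 + d) * (2 + d) + 3 * (2 + d)) + (Q d + (2 * d + 8) * suc d)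
  Q-step d = begin
    r + (∑△ (λ a b → q (suc a) (suc b)) d + (r + 0))
      ≡⟨ cong (λ z → r + (z + (r + 0))) inner ⟩
    r + (Q d + (2 * d + 8) * suc d + (r + 0))
      ≡⟨ lemma r (Q d) ((2 * d + 8) * suc d) ⟩
    2 * r + (Q d + (2 * d + 8) * suc d) ∎
    where
    open ≡-Reasoning
    r : ℕ
    r = (2 + d) * (2 + d) + 3 * (2 + d)
    lemma : ∀ r x y → r + (x + y + (r + 0)) ≡ 2 * r + (x + y)
    lemma = solve-∀
    inner : ∑△ (λ a b → q (suc a) (suc b)) d ≡ Q d + (2 * d + 8) * suc d
    inner = begin
      ∑△ (λ a b → q (suc a) (suc b)) d
        ≡⟨ ∑△-cong d (λ a b eq → trans (q-suc {a} {b} eq)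
             (cong (q a b +_) (sym (*-identityʳ (2 * d + 8))))) ⟩
      ∑△ (λ a b → q a b + (2 * d + 8) * 1) d
        ≡⟨ ∑△-+ q (λ _ _ → (2 * d + 8) * 1) d ⟩
      Q d + ∑△ (λ _ _ → (2 * d + 8) * 1) d
        ≡⟨ cong (Q d +_) (trans (∑△-* (2 * d + 8) (λ _ _ → 1) d)
             (cong ((2 * d + 8) *_) (∑△-1 d))) ⟩
      Q d + (2 * d + 8) * suc d ∎

  -- After the shift a term is `(2 + (a ⊔ b)) * (q a b + c)` with `c = 2 * d + 8`; split as in
  -- `expand`, it feeds `G`, `Q` and `N` in turn.
  G-step : ∀ d → G (2 + d) ≡
           2 * ((3 + d) * ((2 + d) * (2 + d) + 3 * (2 + d))) + (G d + (Q d + (2 * d + 8) * N d))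
  G-step d = begin
    (3 + d) * r + (∑△ (λ a b → (2 + (a ⊔ b)) * q (suc a) (suc b)) d + (3 + d) * (r + 0))
      ≡⟨ cong (λ z → (3 + d) * r + (z + (3 + d) * (r + 0))) inner ⟩
    (3 + d) * r + (G d + (Q d + (2 * d + 8) * N d) + (3 + d) * (r + 0))
      ≡⟨ lemma d r (G d + (Q d + (2 * d + 8) * N d)) ⟩
    2 * ((3 + d) * r) + (G d + (Q d + (2 * d + 8) * N d)) ∎
    where
    open ≡-Reasoning
    r : ℕ
    r = (2 + d) * (2 + d) + 3 * (2 + d)
    lemma : ∀ d r x → (3 + d) * r + (x + (3 + d) * (r + 0)) ≡ 2 * ((3 + d) * r) + x
    lemma = solve-∀
    expand : ∀ m x c → (2 + m) * (x + c) ≡ suc m * x + (x + c * (2 + m))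
    expand = solve-∀
    inner : ∑△ (λ a b → (2 + (a ⊔ b)) * q (suc a) (suc b)) d ≡ G d + (Q d + (2 * d + 8) * N d)
    inner = begin
      ∑△ (λ a b → (2 + (a ⊔ b)) * q (suc a) (suc b)) d
        ≡⟨ ∑△-cong d (λ a b eq → trans (cong ((2 + (a ⊔ b)) *_) (q-suc {a} {b} eq))
             (expand (a ⊔ b) (q a b) (2 * d + 8))) ⟩
      ∑△ (λ a b → suc (a ⊔ b) * q a b + (q a b + (2 * d + 8) * (2 + (a ⊔ b)))) d
        ≡⟨ ∑△-+ (λ a b → suc (a ⊔ b) * q a b) (λ a b → q a b + (2 * d + 8) * (2 + (a ⊔ b))) d ⟩
      G d + ∑△ (λ a b → q a b + (2 * d + 8) * (2 + (a ⊔ b))) d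
        ≡⟨ cong (G d +_) (∑△-+ q (λ a b → (2 * d + 8) * (2 + (a ⊔ b))) d) ⟩
      G d + (Q d + ∑△ (λ a b → (2 * d + 8) * (2 + (a ⊔ b))) d)
        ≡⟨ cong (λ z → G d + (Q d + z)) (∑△-* (2 * d + 8) (λ a b → 2 + (a ⊔ b)) d) ⟩
      G d + (Q d + (2 * d + 8) * N d) ∎

  -- Unlike `2 * k`, it reduces on `suc k` to two constructors, the shape that the two-step
  -- recurrences of `∑△` need.
  double : ℕ → ℕ
  double zero    = zero
  double (suc k) = suc (suc (double k))

  double≡2* : ∀ k → double k ≡ 2 * k
  double≡2* zero    = refl
  double≡2* (suc k) = trans (cong (2 +_) (double≡2* k)) (lemma k)
    where
    lemma : ∀ k → 2 + 2 * k ≡ 2 * suc k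
    lemma = solve-∀

  even⊎odd : ∀ n → ∃[ k ] (n ≡ double k ⊎ n ≡ suc (double k))
  even⊎odd zero = 0 , inj₁ refl
  even⊎odd (suc n) with even⊎odd n
  ... | k , inj₁ refl = k , inj₂ refl
  ... | k , inj₂ refl = suc k , inj₁ refl

  -- The maximum brings in parity: the sum of `a ⊔ b` over `a + b = d` is a different polynomial for
  -- even and for odd `d`.
  N-even : ∀ k → N (double k) ≡ 3 * (k * k) + 6 * k + 2
  N-even zero    = refl
  N-even (suc k) = trans (N-step (double k))
    (trans (cong₂ (λ d n → 2 * (4 + d) + (suc d + n)) (double≡2* k) (N-even k)) (lemma k))
    where
    lemma : ∀ k → 2 * (4 + 2 * k) + (suc (2 * k) + (3 * (k * k) + 6 * k + 2)) ≡
                  3 * (suc k * suc k) + 6 * suc k + 2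
    lemma = solve-∀

  N-odd : ∀ k → N (suc (double k)) ≡ 3 * (k * k) + 9 * k + 6
  N-odd zero    = refl
  N-odd (suc k) = trans (N-step (suc (double k)))
    (trans (cong₂ (λ d n → 2 * (4 + suc d) + (suc (suc d) + n)) (double≡2* k) (N-odd k)) (lemma k))
    where
    lemma : ∀ k → 2 * (4 + suc (2 * k)) + (suc (suc (2 * k)) + (3 * (k * k) + 9 * k + 6)) ≡
                  3 * (suc k * suc k) + 9 * suc k + 6
    lemma = solve-∀

  -- Without the maximum one polynomial serves both parities.
  Q-closed : ∀ d → 3 * Q d ≡ d * suc d * (2 * d + 10)
  Q-closed 0 = refl
  Q-closed 1 = refl
  Q-closed (suc (suc d)) = trans (cong (3 *_) (Q-step d))
    (trans (lemma₁ d (Q d)) (trans (cong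
      (λ x → 6 * ((2 + d) * (2 + d) + 3 * (2 + d)) + (x + 3 * ((2 * d + 8) * suc d)))
      (Q-closed d)) (lemma₂ d)))
    where
    lemma₁ : ∀ d x → 3 * (2 * ((2 + d) * (2 + d) + 3 * (2 + d)) + (x + (2 * d + 8) * suc d)) ≡
                     6 * ((2 + d) * (2 + d) + 3 * (2 + d)) + (3 * x + 3 * ((2 * d + 8) * suc d))
    lemma₁ = solve-∀
    lemma₂ : ∀ d → 6 * ((2 + d) * (2 + d) + 3 * (2 + d)) +
                     (d * suc d * (2 * d + 10) + 3 * ((2 * d + 8) * suc d)) ≡
                   (2 + d) * (3 + d) * (2 * (2 + d) + 10)
    lemma₂ = solve-∀

  G-step′ : ∀ {d e n g} → d ≡ e → N d ≡ n → 3 * G d ≡ g → 3 * G (2 + d) ≡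
            6 * ((3 + e) * ((2 + e) * (2 + e) + 3 * (2 + e))) +
              (g + (e * suc e * (2 * e + 10) + 3 * ((2 * e + 8) * n)))
  G-step′ {d} refl refl refl = trans (cong (3 *_) (G-step d)) (trans
    (lemma ((3 + d) * ((2 + d) * (2 + d) + 3 * (2 + d))) (G d) (Q d) ((2 * d + 8) * N d))
    (cong (λ x → 6 * ((3 + d) * ((2 + d) * (2 + d) + 3 * (2 + d))) +
                   (3 * G d + (x + 3 * ((2 * d + 8) * N d)))) (Q-closed d)))
    where
    lemma : ∀ a g q n → 3 * (2 * a + (g + (q + n))) ≡ 6 * a + (3 * g + (3 * q + 3 * n))
    lemma = solve-∀

  G-even : ∀ k → 3 * G (double k) ≡
           25 * (k * k * k * k) + 94 * (k * k * k) + 89 * (k * k) + 20 * k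
  G-even zero    = refl
  G-even (suc k) = trans (G-step′ (double≡2* k) (N-even k) (G-even k)) (lemma k)
    where
    lemma : ∀ k → 6 * ((3 + 2 * k) * ((2 + 2 * k) * (2 + 2 * k) + 3 * (2 + 2 * k))) +
      (25 * (k * k * k * k) + 94 * (k * k * k) + 89 * (k * k) + 20 * k +
        (2 * k * suc (2 * k) * (2 * (2 * k) + 10) +
          3 * ((2 * (2 * k) + 8) * (3 * (k * k) + 6 * k + 2)))) ≡
      25 * (suc k * suc k * suc k * suc k) + 94 * (suc k * suc k * suc k) +
        89 * (suc k * suc k) + 20 * suc k
    lemma = solve-∀

  G-odd : ∀ k → 3 * G (suc (double k)) ≡
          25 * (k * k * k * k) + 144 * (k * k * k) + 269 * (k * k) + 198 * k + 48
  G-odd zero    = refl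
  G-odd (suc k) = trans (G-step′ (cong suc (double≡2* k)) (N-odd k) (G-odd k)) (lemma k)
    where
    lemma : ∀ k → 6 * ((3 + (1 + 2 * k)) *
        ((2 + (1 + 2 * k)) * (2 + (1 + 2 * k)) + 3 * (2 + (1 + 2 * k)))) +
      (25 * (k * k * k * k) + 144 * (k * k * k) + 269 * (k * k) + 198 * k + 48 +
        ((1 + 2 * k) * suc (1 + 2 * k) * (2 * (1 + 2 * k) + 10) +
          3 * ((2 * (1 + 2 * k) + 8) * (3 * (k * k) + 9 * k + 6)))) ≡
      25 * (suc k * suc k * suc k * suc k) + 144 * (suc k * suc k * suc k) +
        269 * (suc k * suc k) + 198 * suc k + 48
    lemma = solve-∀

  Φ-step′ : ∀ {d e g} → d ≡ e → 3 * G d ≡ g →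
            6 * Φ (2 + d) ≡ 6 * ((2 + e) * (suc e * suc e + 3 * suc e)) + g
  Φ-step′ {d} refl refl = trans (lemma₁ (Φ (2 + d))) (trans (cong (3 *_) (Φ-step d))
    (lemma₂ ((2 + d) * (suc d * suc d + 3 * suc d)) (G d)))
    where
    lemma₁ : ∀ x → 6 * x ≡ 3 * (2 * x)
    lemma₁ = solve-∀
    lemma₂ : ∀ x y → 3 * (2 * x + y) ≡ 6 * x + 3 * y
    lemma₂ = solve-∀

  Φ-even : ∀ k → 6 * Φ (double (suc k)) ≡
           25 * (k * k * k * k) + 142 * (k * k * k) + 257 * (k * k) + 188 * k + 48
  Φ-even k = trans (Φ-step′ (double≡2* k) (G-even k)) (lemma k)
    where
    lemma : ∀ k → 6 * ((2 + 2 * k) * (suc (2 * k) * suc (2 * k) + 3 * suc (2 * k))) +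
      (25 * (k * k * k * k) + 94 * (k * k * k) + 89 * (k * k) + 20 * k) ≡
      25 * (k * k * k * k) + 142 * (k * k * k) + 257 * (k * k) + 188 * k + 48
    lemma = solve-∀

  Φ-odd : ∀ k → 6 * Φ (suc (double k)) ≡
          25 * (k * k * k * k) + 92 * (k * k * k) + 83 * (k * k) + 28 * k
  Φ-odd zero    = refl
  Φ-odd (suc k) = trans (Φ-step′ (cong suc (double≡2* k)) (G-odd k)) (lemma k)
    where
    lemma : ∀ k → 6 * ((2 + (1 + 2 * k)) *
        (suc (1 + 2 * k) * suc (1 + 2 * k) + 3 * suc (1 + 2 * k))) +
      (25 * (k * k * k * k) + 144 * (k * k * k) + 269 * (k * k) + 198 * k + 48) ≡
      25 * (suc k * suc k * suc k * suc k) + 92 * (suc k * suc k * suc k) +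
        83 * (suc k * suc k) + 28 * suc k
    lemma = solve-∀

  -- An even number `2 + d` of edges means odd order `3 + d`, hence the constants 178 and 135 of the
  -- odd bound. The subtracted terms stand on the other side, which keeps the identity in ℕ.
  bound-even : ∀ k d φ → d ≡ 2 * k →
    6 * φ ≡ 25 * (k * k * k * k) + 142 * (k * k * k) + 257 * (k * k) + 188 * k + 48 →
    25 * (3 + d) ^ 4 + 304 * (3 + d) ≡
    96 * φ + (16 * (3 + d) ^ 3 + 178 * (3 + d) ^ 2 + 135)
  bound-even k _ φ refl eq = trans (lemma k)
    (cong (_+ (16 * (3 + 2 * k) ^ 3 + 178 * (3 + 2 * k) ^ 2 + 135))
      {x = 16 * (25 * (k * k * k * k) + 142 * (k * k * k) + 257 * (k * k) + 188 * k + 48)}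
      {y = 96 * φ} (trans (cong (16 *_) (sym eq)) (sym (*-assoc 16 6 φ))))
    where
    lemma : ∀ k →
      25 * ((3 + 2 * k) * ((3 + 2 * k) * ((3 + 2 * k) * ((3 + 2 * k) * 1)))) + 304 * (3 + 2 * k) ≡
      16 * (25 * (k * k * k * k) + 142 * (k * k * k) + 257 * (k * k) + 188 * k + 48) +
        (16 * ((3 + 2 * k) * ((3 + 2 * k) * ((3 + 2 * k) * 1))) +
          178 * ((3 + 2 * k) * ((3 + 2 * k) * 1)) + 135)
    lemma = solve-∀

  bound-odd : ∀ k d φ → d ≡ 2 * k →
    6 * φ ≡ 25 * (k * k * k * k) + 92 * (k * k * k) + 83 * (k * k) + 28 * k →
    25 * (2 + d) ^ 4 + 304 * (2 + d) ≡
    96 * φ + (16 * (2 + d) ^ 3 + 172 * (2 + d) ^ 2 + 192)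
  bound-odd k _ φ refl eq = trans (lemma k)
    (cong (_+ (16 * (2 + 2 * k) ^ 3 + 172 * (2 + 2 * k) ^ 2 + 192))
      {x = 16 * (25 * (k * k * k * k) + 92 * (k * k * k) + 83 * (k * k) + 28 * k)}
      {y = 96 * φ} (trans (cong (16 *_) (sym eq)) (sym (*-assoc 16 6 φ))))
    where
    lemma : ∀ k →
      25 * ((2 + 2 * k) * ((2 + 2 * k) * ((2 + 2 * k) * ((2 + 2 * k) * 1)))) + 304 * (2 + 2 * k) ≡
      16 * (25 * (k * k * k * k) + 92 * (k * k * k) + 83 * (k * k) + 28 * k) +
        (16 * ((2 + 2 * k) * ((2 + 2 * k) * ((2 + 2 * k) * 1))) +
          172 * ((2 + 2 * k) * ((2 + 2 * k) * 1)) + 192)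
    lemma = solve-∀

  -- Trees compared with the path

  m+1+n≡o⇒m<o : ∀ {m n o} → m + suc n ≡ o → m < o
  m+1+n≡o⇒m<o {m} refl = m<m+n m z<s

  -- With n = m + 1 edges present, n (n + 1) (n + 2) bounds what a new leaf can add without
  -- increasing the diameter.
  Φ-gap : ∀ m → Φ (suc m) + suc m * ((2 + m) * (3 + m)) < Φ (2 + m)
  Φ-gap m with even⊎odd m
  -- The `suc` term below is six times the gap; its cubic coefficient is what remains of 142 - 92 -
  -- 48. No coefficient is negative, and the `suc` gives strictness.
  ... | k , inj₁ refl = *-cancelˡ-< 6 _ _ (m+1+n≡o⇒m<o (begin
    6 * (Φ (suc (double k)) + suc (double k) * ((2 + double k) * (3 + double k))) +
      suc (2 * (k * k * k) + 30 * (k * k) + 28 * k + 11)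
      ≡⟨ cong (_+ suc (2 * (k * k * k) + 30 * (k * k) + 28 * k + 11))
           (trans (*-distribˡ-+ 6 (Φ (suc (double k))) _)
                  (cong₂ (λ x d → x + 6 * (suc d * ((2 + d) * (3 + d))))
                         (Φ-odd k) (double≡2* k))) ⟩
    25 * (k * k * k * k) + 92 * (k * k * k) + 83 * (k * k) + 28 * k +
      6 * (suc (2 * k) * ((2 + 2 * k) * (3 + 2 * k))) +
      suc (2 * (k * k * k) + 30 * (k * k) + 28 * k + 11)
      ≡⟨ lemma k ⟩
    25 * (k * k * k * k) + 142 * (k * k * k) + 257 * (k * k) + 188 * k + 48
      ≡⟨ Φ-even k ⟨
    6 * Φ (double (suc k)) ∎))
    where
    open ≡-Reasoning
    lemma : ∀ k → 25 * (k * k * k * k) + 92 * (k * k * k) + 83 * (k * k) + 28 * k +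
      6 * (suc (2 * k) * ((2 + 2 * k) * (3 + 2 * k))) +
      suc (2 * (k * k * k) + 30 * (k * k) + 28 * k + 11) ≡
      25 * (k * k * k * k) + 142 * (k * k * k) + 257 * (k * k) + 188 * k + 48
    lemma = solve-∀
  ... | k , inj₂ refl = *-cancelˡ-< 6 _ _ (m+1+n≡o⇒m<o (begin
    6 * (Φ (double (suc k)) + (2 + double k) * ((3 + double k) * (4 + double k))) +
      suc (2 * (k * k * k) + 36 * (k * k) + 70 * k + 35)
      ≡⟨ cong (_+ suc (2 * (k * k * k) + 36 * (k * k) + 70 * k + 35))
           (trans (*-distribˡ-+ 6 (Φ (double (suc k))) _)
                  (cong₂ (λ x d → x + 6 * ((2 + d) * ((3 + d) * (4 + d))))
                         (Φ-even k) (double≡2* k))) ⟩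
    25 * (k * k * k * k) + 142 * (k * k * k) + 257 * (k * k) + 188 * k + 48 +
      6 * ((2 + 2 * k) * ((3 + 2 * k) * (4 + 2 * k))) +
      suc (2 * (k * k * k) + 36 * (k * k) + 70 * k + 35)
      ≡⟨ lemma k ⟩
    25 * (suc k * suc k * suc k * suc k) + 92 * (suc k * suc k * suc k) +
        83 * (suc k * suc k) + 28 * suc k
      ≡⟨ Φ-odd (suc k) ⟨
    6 * Φ (suc (double (suc k))) ∎))
    where
    open ≡-Reasoning
    lemma : ∀ k → 25 * (k * k * k * k) + 142 * (k * k * k) + 257 * (k * k) + 188 * k + 48 +
      6 * ((2 + 2 * k) * ((3 + 2 * k) * (4 + 2 * k))) +
      suc (2 * (k * k * k) + 36 * (k * k) + 70 * k + 35) ≡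
      25 * (suc k * suc k * suc k * suc k) + 92 * (suc k * suc k * suc k) +
        83 * (suc k * suc k) + 28 * suc k
    lemma = solve-∀

  -- The starting path is a stage of the growth, not just a subtree, so its ends are carried along
  -- and their distance survives every step by computation.
  data Extends (d : ℕ) : ∀ {m} → Tree m → Set where
    base : Extends d (path d)
    step : ∀ {m} {t : Tree m} {p} → Extends d t → Extends d (grow t p)

  left right : ∀ {d m} {t : Tree m} → Extends d t → Fin (suc m)
  left  base     = zero
  left  (step o) = suc (left o)
  right {d} base = fromℕ d
  right (step o) = suc (right o)

  d-ends : ∀ {d m} {t : Tree m} (o : Extends d t) → d⟨ t ⟩ (left o) (right o) ≡ d
  d-ends {d} base = d-path-right d zero d refl
  d-ends (step o) = d-ends o

  Extends⇒≤ : ∀ {d m} {t : Tree m} → Extends d t → d ≤ m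
  Extends⇒≤ base     = ≤-refl
  Extends⇒≤ (step o) = m≤n⇒m≤1+n (Extends⇒≤ o)

  weight≤Φ : ∀ {d m} {t : Tree m} (o : Extends d t) → (∀ u v → d⟨ t ⟩ u v ≤ d) →
             weight t (left o) (right o) ≤ Φ m
  weight<Φ : ∀ {d m} {t : Tree m} {p} (o : Extends d t) → (∀ u v → d⟨ grow t p ⟩ u v ≤ d) →
             weight (grow t p) (suc (left o)) (suc (right o)) < Φ (suc m)

  weight≤Φ {d} base diam = ≤-reflexive (weight-path d)
  weight≤Φ (step o) diam = <⇒≤ (weight<Φ o diam)

  -- Two impossible cases precede the use of `Φ-gap`, which needs an old edge: with `d = 0` the leaf
  -- is still at distance 1 from its neighbour, and a tree without edges contains no path of
  -- positive length.
  weight<Φ {zero} {t = t} {p} o diam with () ← diam zero (suc p)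
  weight<Φ {suc d} {zero} o diam with () ← Extends⇒≤ o
  weight<Φ {suc d} {suc m} {t} {p} o diam = begin-strict
    weight (grow t p) (suc (left o)) (suc (right o))
      ≤⟨ weight-grow t p (left o) (right o) diam ⟩
    weight t (left o) (right o) + suc d * ((2 + m) * (3 + m))
      ≤⟨ +-mono-≤ (weight≤Φ o (λ u v → diam (suc u) (suc v))) (*-monoˡ-≤ _ (Extends⇒≤ o)) ⟩
    Φ (suc m) + suc m * ((2 + m) * (3 + m))
      <⟨ Φ-gap m ⟩
    Φ (2 + m) ∎
    where open ≤-Reasoning

-- Reachability and distance in graphs

module Graphs where

  open import Data.Bool using (Bool; true; false; _∨_; if_then_else_)
  open import Data.Bool.Properties using (T-≡; T-∧; ∨-zeroʳ; ¬-not; not-¬; ⇔→≡)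
  open import Data.Fin using (Fin; zero; suc; toℕ; fromℕ; punchOut)
  open import Data.Fin.Permutation
    using (Permutation′; permutation; _⟨$⟩ʳ_; _⟨$⟩ˡ_; inverseˡ; inverseʳ)
  open import Data.Fin.Properties using (_≟_; any?; ¬∀⟶∃¬; injective⇒≤; punchOut-injective)
  open import Data.List using (allFin; map; foldr; tabulate)
  open import Data.List.Membership.Propositional using (lose; find)
  open import Data.List.Membership.Propositional.Properties using (∈-allFin)
  open import Data.List.Properties using (map-tabulate)
  open import Data.List.Relation.Unary.Any.Properties using (any⁺; any⁻)
  open import Data.Nat hiding (_≟_)
  open import Data.Nat.Properties hiding (_≟_)
  open import Algebra.Properties.Semiring.Sum +-*-semiring
  import Data.Nat.ListAction as List
  open import Data.Product using (∃-syntax; _×_; _,_; proj₁; proj₂)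
  open import Data.Sum using (_⊎_; inj₁; inj₂; [_,_]′)
  open import Data.Vec.Functional using (_∷_)
  open import Function using (_∘_; id; Equivalence; mk⇔)
  open import Relation.Binary.PropositionalEquality
  open import Relation.Nullary using (Dec; yes; no; ¬_; contradiction)

  open import Defs renaming (sym to adj-sym)
  open Trees

  list-sum : ∀ {n} (f : Fin n → ℕ) → List.sum (map f (allFin n)) ≡ sum f
  list-sum f = trans (cong List.sum (map-tabulate id f)) (sum-tabulate f)
    where
    sum-tabulate : ∀ {n} (f : Fin n → ℕ) → List.sum (tabulate f) ≡ sum f
    sum-tabulate {zero}  f = refl
    sum-tabulate {suc n} f = cong (f zero +_) (sum-tabulate (f ∘ suc))

  ≤-list-max : ∀ {n} (f : Fin n → ℕ) i → f i ≤ foldr _⊔_ 0 (map f (allFin n))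
  ≤-list-max f i = ≤-trans (≤-max-tabulate f i)
    (≤-reflexive (sym (cong (foldr _⊔_ 0) (map-tabulate id f))))
    where
    ≤-max-tabulate : ∀ {n} (f : Fin n → ℕ) i → f i ≤ foldr _⊔_ 0 (tabulate f)
    ≤-max-tabulate f zero    = m≤m⊔n _ _
    ≤-max-tabulate f (suc i) = ≤-trans (≤-max-tabulate (f ∘ suc) i) (m≤n⊔m _ _)

  list-max-≤ : ∀ {n} (f : Fin n → ℕ) {b} → (∀ i → f i ≤ b) → foldr _⊔_ 0 (map f (allFin n)) ≤ b
  list-max-≤ f f≤b = ≤-trans (≤-reflexive (cong (foldr _⊔_ 0) (map-tabulate id f)))
    (max-tabulate-≤ f f≤b)
    where
    max-tabulate-≤ : ∀ {n} (f : Fin n → ℕ) {b} → (∀ i → f i ≤ b) → foldr _⊔_ 0 (tabulate f) ≤ b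
    max-tabulate-≤ {zero}  f f≤b = z≤n
    max-tabulate-≤ {suc n} f f≤b = ⊔-lub (f≤b zero) (max-tabulate-≤ (f ∘ suc) (f≤b ∘ suc))

  injective⇒surjective : ∀ {n} {f : Fin n → Fin n} → (∀ {i j} → f i ≡ f j → i ≡ j) →
                         ∀ y → ∃[ x ] f x ≡ y
  injective⇒surjective {suc n} {f} inj y with any? (λ x → f x ≟ y)
  ... | yes y∈f = y∈f
  ... | no  y∉f = contradiction
    (injective⇒≤ {f = λ x → punchOut (y≢f x)}
      (λ {i} {j} eq → inj (punchOut-injective (y≢f i) (y≢f j) eq)))
    1+n≰n
    where
    y≢f : ∀ x → y ≢ f x
    y≢f x eq = y∉f (x , sym eq)

  missing : ∀ {m n} → m < n → (f : Fin m → Fin n) → ∃[ y ] (∀ x → f x ≢ y)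
  missing {n = n} m<n f =
    let y , y∉f = ¬∀⟶∃¬ n (λ y → ∃[ x ] f x ≡ y) (λ y → any? (λ x → f x ≟ y)) not-onto
    in  y , λ x eq → y∉f (x , eq)
    where
    not-onto : ¬ (∀ y → ∃[ x ] f x ≡ y)
    not-onto onto = <⇒≱ m<n (injective⇒≤ {f = proj₁ ∘ onto} λ {y} {z} eq →
      trans (sym (proj₂ (onto y))) (trans (cong f eq) (proj₂ (onto z))))

  module _ {n} (G : Graph n) where

    reach-refl : ∀ u → reach G 0 u u ≡ true
    reach-refl u with u ≟ u
    ... | yes _   = refl
    ... | no  u≢u = contradiction refl u≢u

    reach-zero⁻ : ∀ {u v} → reach G 0 u v ≡ true → u ≡ v
    reach-zero⁻ {u} {v} r with u ≟ v
    ... | yes u≡v = u≡v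

    reach-step : ∀ k {u w v} → reach G k u w ≡ true → Adj G w v → reach G (suc k) u v ≡ true
    reach-step k {u} {w} {v} r a = trans (cong (reach G k u v ∨_)
      (Equivalence.to T-≡ (any⁺ _ (lose (∈-allFin w)
        (Equivalence.from T-∧ (Equivalence.from T-≡ r , Equivalence.from T-≡ a))))))
      (∨-zeroʳ (reach G k u v))

    reach-step⁻ : ∀ k {u v} → reach G (suc k) u v ≡ true →
                  reach G k u v ≡ true ⊎ ∃[ w ] (reach G k u w ≡ true × Adj G w v)
    reach-step⁻ k {u} {v} r with reach G k u v
    ... | true  = inj₁ refl
    ... | false
      with w , _ , rw ← find (any⁻ _ (allFin n) (Equivalence.from T-≡ r))
      with ru , a ← Equivalence.to T-∧ rw
      = inj₂ (w , Equivalence.to T-≡ ru , Equivalence.to T-≡ a)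

    least≤ : ∀ p f {k} → p k ≡ true → least G p f ≤ k
    least≤ p zero    pk = z≤n
    least≤ p (suc f) {k} pk with p 0 in p0
    ... | true  = z≤n
    least≤ p (suc f) {zero}  pk | false = contradiction (trans (sym pk) p0) λ ()
    least≤ p (suc f) {suc k} pk | false = s≤s (least≤ (p ∘ suc) f pk)

    -- The default value of `least` is its fuel, hence the condition `m ≤ f`.
    ≤least : ∀ p f {m} → m ≤ f → (∀ k → p k ≡ true → m ≤ k) → m ≤ least G p f
    ≤least p f       {zero}  _         _  = z≤n
    ≤least p (suc f) {suc m} (s≤s m≤f) lb with p 0 in p0
    ... | true  = contradiction (lb 0 p0) λ ()
    ... | false = s≤s (≤least (p ∘ suc) f m≤f (λ k pk → s≤s⁻¹ (lb (suc k) pk)))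

    least-suc : ∀ p f → p 0 ≡ false → least G p (suc f) ≡ suc (least G (p ∘ suc) f)
    least-suc p f p0 rewrite p0 = refl

    least-zero : ∀ p f → p 0 ≡ true → least G p f ≡ 0
    least-zero p f p0 = n≤0⇒n≡0 (least≤ p f p0)

  indicator : Bool → ℕ
  indicator b = if b then 1 else 0

  -- `far` alters only the value 1, and distance 1 is adjacency. Summed over `v`, this splits the
  -- total distance into a `far` sum and the degree, so that ξᵈ - ξᶜ becomes a sum in ℕ.
  dist-far : ∀ {n} (G : Graph n) u v → dist G u v ≡ far (dist G u v) + indicator (adj G u v)
  dist-far {suc n} G u v = by-cases n G (u ≟ v) (adj G u v) refl
    where
    by-cases : ∀ n (G : Graph (suc n)) {u v} → Dec (u ≡ v) → ∀ b → adj G u v ≡ b →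
               dist G u v ≡ far (dist G u v) + indicator b
    by-cases n G {u} (yes refl) b a =
      subst₂ (λ x b → x ≡ far x + indicator b)
        (sym (least-zero G (λ k → reach G k u u) (suc n) (reach-refl G u)))
        (trans (sym (irrefl G u)) a) refl
    -- A single vertex is set apart because its fuel is 1; from two vertices on, `least` can be
    -- unfolded at both 0 and 1.
    by-cases zero G {zero} {zero} (no 0≢0) b a = contradiction refl 0≢0
    by-cases (suc n) G {u} {v} (no u≢v) true a = subst (λ x → x ≡ far x + 1) (sym D≡1) refl
      where
      D≡1 : dist G u v ≡ 1
      D≡1 = trans (least-suc G (λ k → reach G k u v) (suc n) (¬-not (u≢v ∘ reach-zero⁻ G)))
        (cong suc (least-zero G (λ k → reach G (suc k) u v) (suc n)
          (reach-step G 0 (reach-refl G u) a)))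
    by-cases (suc n) G {u} {v} (no u≢v) false a =
      subst (λ x → x ≡ far x + 0) (sym D≡2+) (sym (+-identityʳ _))
      where
      unreachable : ¬ (reach G 1 u v ≡ true)
      unreachable r = [ u≢v ∘ reach-zero⁻ G
                      , (λ (w , r₀ , b) → not-¬ a
                          (subst (λ x → adj G x v ≡ true) (sym (reach-zero⁻ G r₀)) b)) ]′
                      (reach-step⁻ G 0 r)
      D≡2+ : dist G u v ≡ 2 + least G (λ k → reach G (2 + k) u v) n
      D≡2+ = trans (least-suc G (λ k → reach G k u v) (suc n) (¬-not (u≢v ∘ reach-zero⁻ G)))
        (cong suc (least-suc G (λ k → reach G (suc k) u v) n (¬-not unreachable)))

  -- The difference of the invariants, and trees inside a graph

  ξ⁻ : ∀ {n} → Graph n → ℕ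
  ξ⁻ G = sum λ u → ecc G u * sum (λ v → far (dist G u v))

  ξd≡ξ⁻+ξc : ∀ {n} (G : Graph n) → ξd G ≡ ξ⁻ G + ξc G
  ξd≡ξ⁻+ξc {n} G = begin
    ξd G
      ≡⟨ list-sum (λ u → ecc G u * totalDist G u) ⟩
    sum (λ u → ecc G u * totalDist G u)
      ≡⟨ sum-cong-≗ (λ u → trans (cong (ecc G u *_) (totalDist≡ u)) (*-distribˡ-+ (ecc G u) _ (deg G u))) ⟩
    sum (λ u → ecc G u * sum (λ v → far (dist G u v)) + ecc G u * deg G u)
      ≡⟨ ∑-distrib-+ (λ u → ecc G u * sum (λ v → far (dist G u v))) (λ u → ecc G u * deg G u) ⟩
    ξ⁻ G + sum (λ u → ecc G u * deg G u)
      ≡⟨ cong (ξ⁻ G +_) (list-sum (λ u → ecc G u * deg G u)) ⟨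
    ξ⁻ G + ξc G ∎
    where
    open ≡-Reasoning
    totalDist≡ : ∀ u → totalDist G u ≡ sum (λ v → far (dist G u v)) + deg G u
    totalDist≡ u = begin
      totalDist G u                                            ≡⟨ list-sum (dist G u) ⟩
      sum (dist G u)                                           ≡⟨ sum-cong-≗ (dist-far G u) ⟩
      sum (λ v → far (dist G u v) + indicator (adj G u v))
        ≡⟨ ∑-distrib-+ (λ v → far (dist G u v)) (λ v → indicator (adj G u v)) ⟩
      sum (λ v → far (dist G u v)) + sum (λ v → indicator (adj G u v))
        ≡⟨ cong (sum (λ v → far (dist G u v)) +_) (list-sum (λ v → indicator (adj G u v))) ⟨
      sum (λ v → far (dist G u v)) + deg G u                   ∎

  -- A subgraph copy, not an induced one: `G` may have further edges between images. The edges of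
  -- the tree are the pairs at distance 1.
  record Embedding {n m} (G : Graph n) (t : Tree m) (φ : Fin (suc m) → Fin n) : Set where
    field
      injective : ∀ {u v} → φ u ≡ φ v → u ≡ v
      edge      : ∀ {u v} → d⟨ t ⟩ u v ≡ 1 → Adj G (φ u) (φ v)
  open Embedding

  module _ {n} {G : Graph n} where

    embed-one : ∀ x → Embedding G one (λ _ → x)
    embed-one x .injective {zero} {zero} _  = refl
    embed-one x .edge      {zero} {zero} ()

    embed-grow : ∀ {m} {t : Tree m} {φ p x} → Embedding G t φ → (∀ u → φ u ≢ x) →
                 Adj G (φ p) x → Embedding G (grow t p) (x ∷ φ)
    embed-grow e x∉φ a .injective {zero}  {zero}  _  = refl
    embed-grow e x∉φ a .injective {zero}  {suc v} eq = contradiction (sym eq) (x∉φ v)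
    embed-grow e x∉φ a .injective {suc u} {zero}  eq = contradiction eq (x∉φ u)
    embed-grow e x∉φ a .injective {suc u} {suc v} eq = cong suc (injective e eq)
    embed-grow {t = t} {p = p} e x∉φ a .edge {zero} {suc v} d≡1
      rewrite sym (d≡0⇒≡ t p v (suc-injective d≡1)) = trans (adj-sym G _ _) a
    embed-grow {t = t} {p = p} e x∉φ a .edge {suc u} {zero} d≡1
      rewrite d≡0⇒≡ t u p (suc-injective d≡1) = a
    embed-grow e x∉φ a .edge {suc u} {suc v} d≡1 = edge e d≡1

    embed-reach : ∀ {m} {t : Tree m} {φ} → Embedding G t φ →
                  ∀ k u v → d⟨ t ⟩ u v ≡ k → reach G k (φ u) (φ v) ≡ true
    embed-reach {t = t} {φ} e zero u v d≡0 rewrite d≡0⇒≡ t u v d≡0 = reach-refl G (φ v)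
    embed-reach {t = t} e (suc k) u v d≡ with w , d₁ , d₂ ← penultimate t u v d≡ =
      reach-step G k (embed-reach e k u w d₁) (edge e d₂)

    dist≤d : ∀ {m} {t : Tree m} {φ} → Embedding G t φ →
             ∀ u v → dist G (φ u) (φ v) ≤ d⟨ t ⟩ u v
    dist≤d e u v = least≤ G _ n (embed-reach e _ u v refl)

    -- The walk is read backwards from `y`, outside the image: either its last edge comes from the
    -- image, or the vertex before is outside too.
    boundary-edge : ∀ {m} (φ : Fin m → Fin n) {u y} → (∀ x → φ x ≢ y) →
                    ∀ k → reach G k (φ u) y ≡ true →
                    ∃[ p ] ∃[ x ] ((∀ u → φ u ≢ x) × Adj G (φ p) x)
    boundary-edge φ {u} y∉φ zero    r = contradiction (reach-zero⁻ G r) (y∉φ u)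
    boundary-edge φ {u} {y} y∉φ (suc k) r with reach-step⁻ G k r
    ... | inj₁ r′ = boundary-edge φ y∉φ k r′
    ... | inj₂ (w , r′ , a) with any? (λ x → φ x ≟ w)
    ...   | yes (p , refl) = p , y , y∉φ , a
    ...   | no w∉φ         = boundary-edge φ (λ x eq → w∉φ (x , eq)) k r′

    -- The last clause keeps the next vertex fresh: all vertices so far are images of vertices
    -- within `k` of `u`, and the next is at distance `suc k`. The equation for `χ zero` places
    -- `φ v` where `path` hangs its next leaf.
    embed-geodesic : ∀ {m} {t : Tree m} {φ} → Embedding G t φ → ∀ k u v → d⟨ t ⟩ u v ≡ k →
                     ∃[ χ ] (Embedding G (path k) χ × χ zero ≡ φ v ×
                             (∀ a → ∃[ w ] (χ a ≡ φ w × d⟨ t ⟩ u w ≤ k)))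
    embed-geodesic {φ = φ} e zero u v d≡ =
      (λ _ → φ v) , embed-one (φ v) , refl , λ _ → v , refl , ≤-reflexive d≡
    embed-geodesic {t = t} {φ} e (suc k) u v d≡
      with w , d₁ , d₂ ← penultimate t u v d≡
      with χ , f , χ₀ , close ← embed-geodesic e k u w d₁ =
      φ v ∷ χ , embed-grow f fresh (subst (λ x → Adj G x (φ v)) (sym χ₀) (edge e d₂)) , refl ,
      λ { zero    → v , refl , ≤-reflexive d≡
        ; (suc a) → let x , eq , le = close a in x , eq , m≤n⇒m≤1+n le }
      where
      fresh : ∀ a → χ a ≢ φ v
      fresh a eq with x , eq′ , le ← close a
        rewrite injective e (trans (sym eq′) eq) =
        contradiction (≤-trans (≤-reflexive (sym d≡)) le) 1+n≰n

  -- Spanning trees grown from a diametral path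

  module _ {N} (G : Graph (suc N)) (connected : Connected G) where

    span : ∀ k {m d} {t : Tree m} {φ} → k + m ≡ N → Extends d t → Embedding G t φ →
           ∃[ t′ ] (Extends d {N} t′ × ∃[ φ′ ] Embedding G t′ φ′)
    span zero    refl o e = _ , o , _ , e
    span (suc k) {m} {φ = φ} eq o e =
      let m<N = ≤-trans (m≤n+m (suc m) k) (≤-reflexive (trans (+-suc k m) eq))
          y , y∉φ = missing (s≤s m<N) φ
          l , r = connected (φ zero) y
          p , x , x∉φ , a = boundary-edge φ y∉φ l r
      in  span k (trans (+-suc k m) eq) (step o) (embed-grow e x∉φ a)

    record DiametralSpanningTree : Set where
      field
        {d}       : ℕ
        {tree}    : Tree N
        extends   : Extends d tree
        φ         : Fin (suc N) → Fin (suc N)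
        embedding : Embedding G tree φ
        diameter  : ∀ u v → d⟨ tree ⟩ u v ≤ d

    -- If the spanning tree has a distance beyond `d`, it is discarded and that geodesic becomes the
    -- new starting path. As no distance exceeds `N`, the invariant `N ≤ fuel + d` ends the search.
    lengthen : ∀ fuel {d χ} → N ≤ fuel + d → Embedding G (path d) χ → DiametralSpanningTree
    lengthen fuel {d} enough e
      with t , o , φ , f ← span (N ∸ d) (m∸n+n≡m (s≤s⁻¹ (injective⇒≤ (injective e)))) base e
      with any? (λ u → any? (λ v → d <? d⟨ t ⟩ u v))
    ... | no short = record
      { extends = o ; φ = φ ; embedding = f
      ; diameter = λ u v → ≮⇒≥ λ d< → short (u , v , d<) }
    lengthen zero enough e | yes (u , v , d<) =
      contradiction (≤-trans d< (≤-trans (d≤edges t u v) enough)) 1+n≰n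
    lengthen (suc fuel) {d} enough e | yes (u , v , d<)
      with χ , g , _ ← embed-geodesic f _ u v refl =
      lengthen fuel
        (≤-trans enough (≤-trans (≤-reflexive (sym (+-suc fuel d))) (+-monoʳ-≤ fuel d<))) g

    diametral-spanning-tree : DiametralSpanningTree
    diametral-spanning-tree = lengthen N {0} (m≤m+n N 0) (embed-one zero)

  -- The graph against its spanning tree, and the case of equality

  embedding⇒permutation : ∀ {N} {G : Graph (suc N)} {t : Tree N} {φ} → Embedding G t φ →
                          Permutation′ (suc N)
  embedding⇒permutation {φ = φ} e = permutation φ (proj₁ ∘ onto) (proj₂ ∘ onto)
    (λ x → injective e (proj₂ (onto (φ x))))
    where onto = injective⇒surjective (injective e)

  ξ⁻-permute : ∀ {n} (G : Graph n) (π : Permutation′ n) → ξ⁻ G ≡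
    sum λ u → ecc G (π ⟨$⟩ʳ u) * sum λ v → far (dist G (π ⟨$⟩ʳ u) (π ⟨$⟩ʳ v))
  ξ⁻-permute G π = trans (sum-permute (λ u → ecc G u * sum λ v → far (dist G u v)) π)
    (sum-cong-≗ λ u → cong (ecc G (π ⟨$⟩ʳ u) *_)
      (sum-permute (λ v → far (dist G (π ⟨$⟩ʳ u) v)) π))

  adjacent⇒pathAdj : ∀ {n} (i j : Fin n) → ∣ toℕ i - toℕ j ∣ ≡ 1 → pathAdj i j ≡ true
  adjacent⇒pathAdj i j eq with suc (toℕ i) Data.Nat.≟ toℕ j | suc (toℕ j) Data.Nat.≟ toℕ i
  ... | yes _ | _     = refl
  ... | no  _ | yes _ = refl
  ... | no ¬a | no ¬b = contradiction (successive (toℕ i) (toℕ j) eq) [ ¬a , ¬b ]′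
    where
    successive : ∀ a b → ∣ a - b ∣ ≡ 1 → suc a ≡ b ⊎ suc b ≡ a
    successive zero    b       eq = inj₁ (sym eq)
    successive (suc a) zero    eq = inj₂ (sym eq)
    successive (suc a) (suc b) eq = [ inj₁ ∘ cong suc , inj₂ ∘ cong suc ]′ (successive a b eq)

  pathAdj⇒adjacent : ∀ {n} (i j : Fin n) → pathAdj i j ≡ true → ∣ toℕ i - toℕ j ∣ ≡ 1
  pathAdj⇒adjacent i j eq with suc (toℕ i) Data.Nat.≟ toℕ j | suc (toℕ j) Data.Nat.≟ toℕ i
  ... | yes a | _     = trans (cong (∣ toℕ i -_∣) (sym a)) (∣m-1+m∣≡1 (toℕ i))
    where
    ∣m-1+m∣≡1 : ∀ m → ∣ m - suc m ∣ ≡ 1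
    ∣m-1+m∣≡1 zero    = refl
    ∣m-1+m∣≡1 (suc m) = ∣m-1+m∣≡1 m
  ... | no  _ | yes b = trans (cong (∣_- toℕ j ∣) (sym b)) (∣1+m-m∣≡1 (toℕ j))
    where
    ∣1+m-m∣≡1 : ∀ m → ∣ suc m - m ∣ ≡ 1
    ∣1+m-m∣≡1 zero    = refl
    ∣1+m-m∣≡1 (suc m) = ∣1+m-m∣≡1 m

  module _ {N} (G : Graph (suc N)) (connected : Connected G) where

    open DiametralSpanningTree (diametral-spanning-tree G connected)

    π : Permutation′ (suc N)
    π = embedding⇒permutation embedding

    ε : Fin (suc N) → ℕ
    ε u = d⟨ tree ⟩ u (left extends) ⊔ d⟨ tree ⟩ u (right extends)

    d≤ε : ∀ u v → d⟨ tree ⟩ u v ≤ ε u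
    d≤ε = far-from-diametral tree (left extends) (right extends)
      λ u v → ≤-trans (diameter u v) (≤-reflexive (sym (d-ends extends)))

    ecc≤ε : ∀ u → ecc G (φ u) ≤ ε u
    ecc≤ε u = list-max-≤ (dist G (φ u)) λ x →
      subst (λ y → dist G (φ u) y ≤ ε u) (inverseʳ π)
        (≤-trans (dist≤d embedding u (π ⟨$⟩ˡ x)) (d≤ε u (π ⟨$⟩ˡ x)))

    far-dist≤ : ∀ u v → far (dist G (φ u) (φ v)) ≤ far (d⟨ tree ⟩ u v)
    far-dist≤ u v = far-mono (dist≤d embedding u v)

    row≤ : ∀ u → ecc G (φ u) * sum (λ v → far (dist G (φ u) (φ v))) ≤
                 ε u * sum (λ v → far (d⟨ tree ⟩ u v))
    row≤ u = *-mono-≤ (ecc≤ε u) (sum-mono (far-dist≤ u))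

    ξ⁻≤weight : ξ⁻ G ≤ weight tree (left extends) (right extends)
    ξ⁻≤weight = ≤-trans (≤-reflexive (ξ⁻-permute G π)) (sum-mono row≤)

    ξ⁻≤Φ : ξ⁻ G ≤ Φ N
    ξ⁻≤Φ = ≤-trans ξ⁻≤weight (weight≤Φ extends diameter)

    -- An edge of `G` outside the tree joins vertices at tree distance at least 2 but graph distance
    -- 1, so it loses in `far`; tightness of every row excludes this.
    weight≤ξ⁻⇒adjacent : weight tree (left extends) (right extends) ≤ ξ⁻ G →
                         ∀ u v → Adj G (φ u) (φ v) → d⟨ tree ⟩ u v ≡ 1
    weight≤ξ⁻⇒adjacent W≤ξ u v a = by-distance (d⟨ tree ⟩ u v) refl
      where
      dist≡1+far : dist G (φ u) (φ v) ≡ far (dist G (φ u) (φ v)) + 1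
      dist≡1+far = subst (λ b → dist G (φ u) (φ v) ≡ far (dist G (φ u) (φ v)) + indicator b)
        a (dist-far G (φ u) (φ v))
      row-tight : ecc G (φ u) * sum (λ v → far (dist G (φ u) (φ v))) ≡
                  ε u * sum (λ v → far (d⟨ tree ⟩ u v))
      row-tight = sum-tight row≤ (≤-trans W≤ξ (≤-reflexive (ξ⁻-permute G π))) u
      -- Equality of the products yields equality of the `far` sums only after cancelling `ε u`,
      -- which is positive once some tree distance from `u` is.
      far-tight : .{{NonZero (ε u)}} → far (dist G (φ u) (φ v)) ≡ far (d⟨ tree ⟩ u v)
      far-tight = sum-tight (far-dist≤ u) (*-cancelˡ-≤ (ε u)
        (≤-trans (≤-reflexive (sym row-tight)) (*-monoˡ-≤ _ (ecc≤ε u)))) v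
      by-distance : ∀ k → d⟨ tree ⟩ u v ≡ k → k ≡ 1
      by-distance 0 d≡ with refl ← d≡0⇒≡ tree u v d≡ =
        contradiction (trans (sym a) (irrefl G (φ u))) λ ()
      by-distance 1 d≡ = refl
      by-distance (suc (suc k)) d≡ = contradiction (begin-strict
        d⟨ tree ⟩ u v                    ≡⟨ trans (cong far d≡) (sym d≡) ⟨
        far (d⟨ tree ⟩ u v)              ≡⟨ far-tight {{>-nonZero ε>0}} ⟨
        far (dist G (φ u) (φ v))         <⟨ m<m+n _ z<s ⟩
        far (dist G (φ u) (φ v)) + 1     ≡⟨ dist≡1+far ⟨
        dist G (φ u) (φ v)               ≤⟨ dist≤d embedding u v ⟩
        d⟨ tree ⟩ u v                    ∎) (<-irrefl refl)
        where
        open ≤-Reasoning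
        ε>0 : 0 < ε u
        ε>0 = ≤-trans (≤-trans (s≤s z≤n) (≤-reflexive (sym d≡))) (d≤ε u v)

    weight≥Φ⇒path : ∀ {d m} {t : Tree m} (o : Extends d t) → (∀ u v → d⟨ t ⟩ u v ≤ d) →
                    Φ m ≤ weight t (left o) (right o) → t ≡ path m
    weight≥Φ⇒path base     _    _   = refl
    weight≥Φ⇒path (step o) diam Φ≤W = contradiction (weight<Φ o diam) (≤⇒≯ Φ≤W)

    -- Both steps of ξ⁻ ≤ weight ≤ Φ are then equalities. The second makes the tree a path, the
    -- first leaves `G` no edge outside it.
    ξ⁻≡Φ⇒IsPath : ξ⁻ G ≡ Φ N → IsPath G
    ξ⁻≡Φ⇒IsPath ξ≡Φ = π , λ u v → ⇔→≡ {z = true} (mk⇔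
      (λ a → adjacent⇒pathAdj u v (trans (sym (d≡ u v)) (weight≤ξ⁻⇒adjacent W≤ξ u v a)))
      (λ p → edge embedding (trans (d≡ u v) (pathAdj⇒adjacent u v p))))
      where
      W≤ξ : weight tree (left extends) (right extends) ≤ ξ⁻ G
      W≤ξ = ≤-trans (weight≤Φ extends diameter) (≤-reflexive (sym ξ≡Φ))
      d≡ : ∀ u v → d⟨ tree ⟩ u v ≡ ∣ toℕ u - toℕ v ∣
      d≡ u v = trans
        (cong (λ t → d⟨ t ⟩ u v)
          (weight≥Φ⇒path extends diameter (≤-trans (≤-reflexive (sym ξ≡Φ)) ξ⁻≤weight)))
        (d-path N u v)

  -- Each edge of `G` changes the position along the path by one, so no walk is shorter than the
  -- path distance. The opposite inequality is the general bound `ξ⁻≤Φ`.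
  IsPath⇒Φ≤ξ⁻ : ∀ {N} (G : Graph (suc N)) → IsPath G → Φ N ≤ ξ⁻ G
  IsPath⇒Φ≤ξ⁻ {N} G (σ , adj≡) = begin
    Φ N
      ≡⟨ weight-path N ⟨
    weight (path N) zero (fromℕ N)
      ≤⟨ sum-mono (λ u → *-mono-≤ (⊔-lub (d≤ecc u zero) (d≤ecc u (fromℕ N)))
           (sum-mono (λ v → far-mono (d≤dist u v)))) ⟩
    sum (λ u → ecc G (σ ⟨$⟩ʳ u) * sum (λ v → far (dist G (σ ⟨$⟩ʳ u) (σ ⟨$⟩ʳ v))))
      ≡⟨ ξ⁻-permute G σ ⟨
    ξ⁻ G ∎
    where
    open ≤-Reasoning
    δ : Fin (suc N) → Fin (suc N) → ℕ
    δ = d⟨ path N ⟩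
    adjacent : ∀ x y → Adj G x y → δ (σ ⟨$⟩ˡ x) (σ ⟨$⟩ˡ y) ≡ 1
    adjacent x y a = trans (d-path N _ _) (pathAdj⇒adjacent (σ ⟨$⟩ˡ x) (σ ⟨$⟩ˡ y)
      (trans (sym (adj≡ _ _)) (trans (cong₂ (adj G) (inverseʳ σ) (inverseʳ σ)) a)))
    δ≤walk : ∀ k u y → reach G k (σ ⟨$⟩ʳ u) y ≡ true → δ u (σ ⟨$⟩ˡ y) ≤ k
    δ≤walk zero    u y r = ≤-reflexive (trans
      (cong (δ u) (trans (cong (σ ⟨$⟩ˡ_) (sym (reach-zero⁻ G r))) (inverseˡ σ)))
      (d-refl (path N) u))
    δ≤walk (suc k) u y r with reach-step⁻ G k r
    ... | inj₁ r′           = m≤n⇒m≤1+n (δ≤walk k u y r′)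
    ... | inj₂ (w , r′ , a) = begin
      δ u (σ ⟨$⟩ˡ y)                                   ≤⟨ d-triangle (path N) u (σ ⟨$⟩ˡ w) _ ⟩
      δ u (σ ⟨$⟩ˡ w) + δ (σ ⟨$⟩ˡ w) (σ ⟨$⟩ˡ y)         ≤⟨ +-mono-≤ (δ≤walk k u w r′) (≤-reflexive (adjacent w y a)) ⟩
      k + 1                                            ≡⟨ +-comm k 1 ⟩
      suc k                                            ∎
    d≤dist : ∀ u v → δ u v ≤ dist G (σ ⟨$⟩ʳ u) (σ ⟨$⟩ʳ v)
    d≤dist u v = ≤least G _ (suc N) (m≤n⇒m≤1+n (d≤edges (path N) u v)) λ k r →
      subst (λ x → δ u x ≤ k) (inverseˡ σ) (δ≤walk k u (σ ⟨$⟩ʳ v) r)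
    d≤ecc : ∀ u v → δ u v ≤ ecc G (σ ⟨$⟩ʳ u)
    d≤ecc u v = ≤-trans (d≤dist u v) (≤-list-max (dist G (σ ⟨$⟩ʳ u)) (σ ⟨$⟩ʳ v))

-- The closed form as an integer

module Bound where

  open import Data.Integer using (+_; _+_; _-_; _*_)
  open import Data.Integer.Properties using (pos-*)
  import Data.Integer.Tactic.RingSolver as ℤ-Solver
  open import Data.Nat as ℕ using (zero; suc; _%_; _^_)
  open import Data.Sum using (inj₁; inj₂)
  open import Data.Product using (_,_)
  open import Relation.Binary.PropositionalEquality

  open import Defs hiding (sym)
  open Trees

  double-%2 : ∀ k → double k % 2 ≡ 0
  double-%2 zero    = refl
  double-%2 (suc k) = double-%2 k

  suc-double-%2 : ∀ k → suc (double k) % 2 ≡ 1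
  suc-double-%2 zero    = refl
  suc-double-%2 (suc k) = suc-double-%2 k

  bound96-even : ∀ n → n % 2 ≡ 0 → bound96 n ≡
    + (25 ℕ.* n ^ 4) - + (16 ℕ.* n ^ 3) - + (172 ℕ.* n ^ 2) + + (304 ℕ.* n) - + 192
  bound96-even n eq with n % 2 | eq
  ... | zero | refl = refl

  bound96-odd : ∀ n → n % 2 ≡ 1 → bound96 n ≡
    + (25 ℕ.* n ^ 4) - + (16 ℕ.* n ^ 3) - + (178 ℕ.* n ^ 2) + + (304 ℕ.* n) - + 135
  bound96-odd n eq with n % 2 | eq
  ... | suc zero | refl = refl

  regroup : ∀ a b c e f x → a ℕ.+ e ≡ x ℕ.+ (b ℕ.+ c ℕ.+ f) →
            + a - + b - + c + + e - + f ≡ + x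
  regroup a b c e f x eq = begin
    + a - + b - + c + + e - + f                        ≡⟨ lemma₁ (+ a) (+ b) (+ c) (+ e) (+ f) ⟩
    + (a ℕ.+ e) - + (b ℕ.+ c ℕ.+ f)                    ≡⟨ cong (λ z → + z - + (b ℕ.+ c ℕ.+ f)) eq ⟩
    + x + + (b ℕ.+ c ℕ.+ f) - + (b ℕ.+ c ℕ.+ f)        ≡⟨ lemma₂ (+ x) (+ (b ℕ.+ c ℕ.+ f)) ⟩
    + x                                                ∎
    where
    open ≡-Reasoning
    lemma₁ : ∀ a b c e f → a - b - c + e - f ≡ a + e - (b + c + f)
    lemma₁ = ℤ-Solver.solve-∀
    lemma₂ : ∀ x y → x + y - y ≡ x
    lemma₂ = ℤ-Solver.solve-∀

  bound96≡96*Φ : ∀ m → bound96 (suc m) ≡ + (96 ℕ.* Φ m)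
  bound96≡96*Φ m with even⊎odd m
  -- One vertex: `Φ-even` starts at two edges, so this value is computed.
  ... | zero  , inj₁ refl = refl
  ... | suc k , inj₁ refl = trans (bound96-odd (suc m) (suc-double-%2 (suc k)))
    (regroup (25 ℕ.* suc m ^ 4) (16 ℕ.* suc m ^ 3) (178 ℕ.* suc m ^ 2) (304 ℕ.* suc m) 135
             (96 ℕ.* Φ m) (bound-even k (double k) (Φ m) (double≡2* k) (Φ-even k)))
  ... | k     , inj₂ refl = trans (bound96-even (suc m) (double-%2 (suc k)))
    (regroup (25 ℕ.* suc m ^ 4) (16 ℕ.* suc m ^ 3) (172 ℕ.* suc m ^ 2) (304 ℕ.* suc m) 192
             (96 ℕ.* Φ m) (bound-odd k (double k) (Φ m) (double≡2* k) (Φ-odd k)))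

  96*difference : ∀ a b c → a ≡ c ℕ.+ b → + 96 * (+ a - + b) ≡ + (96 ℕ.* c)
  96*difference _ b c refl = trans (cong (+ 96 *_) (lemma (+ c) (+ b))) (sym (pos-* 96 c))
    where
    lemma : ∀ x y → x + y - y ≡ x
    lemma = ℤ-Solver.solve-∀

open import Defs
open import Data.Nat using (ℕ; _≤_)
import Data.Integer
open import Data.Integer using (ℤ; +_; _-_; _*_)
open import Data.Product using (_×_)
open import Relation.Binary.PropositionalEquality using (_≡_)

open import Data.Integer.Properties using (+-injective)
open import Data.Nat using (suc)
open import Data.Nat.Properties using (*-monoʳ-≤; *-cancelˡ-≡; ≤-antisym)
open import Data.Product using (_,_)
open import Relation.Binary.PropositionalEquality using (trans; cong; subst₂)
import Relation.Binary.PropositionalEquality as ≡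
open Trees
open Graphs
open Bound

theorem3p5 : (n : ℕ) → 1 ≤ n → (T : Graph n) → IsTree T →
    ((+ 96) * (+ ξd T - + ξc T) Data.Integer.≤ bound96 n)
    × (((+ 96) * (+ ξd T - + ξc T) ≡ bound96 n → IsPath T)
    × (IsPath T → (+ 96) * (+ ξd T - + ξc T) ≡ bound96 n))
theorem3p5 (suc N) _ T (connected , _) =
    subst₂ Data.Integer._≤_ (≡.sym lhs) (≡.sym rhs)
      (Data.Integer.+≤+ (*-monoʳ-≤ 96 (ξ⁻≤Φ T connected)))
  , (λ eq → ξ⁻≡Φ⇒IsPath T connected
      (*-cancelˡ-≡ (ξ⁻ T) (Φ N) 96 (+-injective (trans (≡.sym lhs) (trans eq rhs)))))
  , (λ isPath → trans lhs (trans
      (cong (λ x → + (96 Data.Nat.* x)) (≤-antisym (ξ⁻≤Φ T connected) (IsPath⇒Φ≤ξ⁻ T isPath)))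
      (≡.sym rhs)))
  where
  lhs : (+ 96) * (+ ξd T - + ξc T) ≡ + (96 Data.Nat.* ξ⁻ T)
  lhs = 96*difference (ξd T) (ξc T) (ξ⁻ T) (ξd≡ξ⁻+ξc T)
  rhs : bound96 (suc N) ≡ + (96 Data.Nat.* Φ N)
  rhs = bound96≡96*Φ N
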